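{- Let $k\ge1$ be an integer and let $\gamma_1,\dots,\gamma_{k-1}$ be the roots of $\Psi_k(x)$. For each $a=1,\dots,k-1$, let $\rho_a$ satisfy \[ \rho_a+\rho_a^{ -1}=\gamma_a,\qquad|\rho_a|<1, \] and define \[ V_n^{(a)}:=\frac{\rho_a^n-\rho_a^{ -n}}{\rho_a-\rho_a^{ -1}}. \] Then \[ V_{n+1}^{(a)}=\gamma_aV_n^{(a)}-V_{n-1}^{(a)} \] holds for all integers $n$.
   Context: For $r\ge1$, $P_r(x)$ is the polynomial defined by $P_r(z+z^{ -1})=z^r+z^{ -r}$, and $\Phi_k(x)=2k-\sum_{r=1}^kP_r(x)$. The polynomial $\Psi_k$, of degree $k-1$, is defined by $\Phi_k(x)=(2-x)\Psi_k(x)$; its complex roots are distinct (a known fact). -}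

module Defs where

open import Level using (0ℓ)
open import Algebra.Bundles using (CommutativeRing; Semiring)
open import Data.Fin.Base using (Fin; toℕ)
open import Data.Integer.Base as Z using (ℤ; -[1+_])
open import Data.List.Base using (List; []; _∷_; foldr)
open import Data.Nat.Base as N using (ℕ; zero; suc)
import Data.Nat.Properties as ℕₚ
open import Data.Product.Base using (∃; _×_; _,_; proj₁; proj₂)
open import Data.Rational.Base as Q
  using (ℚ; mkℚ; 0ℚ; 1ℚ; ½; Positive)
import Data.Rational.Properties as ℚₚ
import Data.Rational.Unnormalised.Base as Qᵘ
import Data.Rational.Unnormalised.Properties as ℚᵘₚ
import Data.Integer.Properties as ℤₚ
open import Data.Rational.Solver using (module +-*-Solver)
open import Data.Sum.Base using (inj₁; inj₂)
open import Function.Definitions using (Injective)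
open import Relation.Binary.PropositionalEquality
  using (_≡_; refl; sym; trans; cong; cong₂; subst; subst₂)
open import Relation.Nullary using (yes; no; contradiction)
import Algebra.Definitions.RawSemiring as RawSemiringDefs
import Algebra.Properties.Ring as RingProperties
open import Function.Bundles using (_⇔_)

module Rat where
  open Q using (_+_; _*_; _-_; -_; _≤_; _<_; ∣_∣)
  open +-*-Solver using (solve; _:+_; _:*_; _:-_; :-_; _:=_; con)

  ≤⇒0≤- : ∀ {p q} → p ≤ q → 0ℚ ≤ q - p
  ≤⇒0≤- {p} {q} p≤q =
    subst (_≤ q - p) (ℚₚ.+-inverseʳ p) (ℚₚ.+-monoˡ-≤ (- p) p≤q)

  0≤-⇒≤ : ∀ {p q} → 0ℚ ≤ q - p → p ≤ q
  0≤-⇒≤ {p} {q} h = subst₂ _≤_ (ℚₚ.+-identityˡ p)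
    (solve 2 (λ p q → (q :- p) :+ p := q) refl p q) (ℚₚ.+-monoˡ-≤ p h)

  +-nonNeg : ∀ {p q} → 0ℚ ≤ p → 0ℚ ≤ q → 0ℚ ≤ p + q
  +-nonNeg = ℚₚ.+-mono-≤

  *-nonNeg : ∀ {p q} → 0ℚ ≤ p → 0ℚ ≤ q → 0ℚ ≤ p * q
  *-nonNeg {p} {q} hp hq = subst (_≤ p * q) (ℚₚ.*-zeroˡ q)
    (ℚₚ.*-monoʳ-≤-nonNeg q {{Q.nonNegative hq}} hp)

  *-pos : ∀ {p q} → 0ℚ < p → 0ℚ < q → 0ℚ < p * q
  *-pos {p} {q} hp hq = subst (_< p * q) (ℚₚ.*-zeroˡ q)
    (ℚₚ.*-monoˡ-<-pos q {{Q.positive hq}} hp)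

  *-mono-≤ : ∀ {p q r s} → 0ℚ ≤ r → 0ℚ ≤ q → p ≤ q → r ≤ s → p * r ≤ q * s
  *-mono-≤ {p} {q} {r} {s} 0≤r 0≤q p≤q r≤s = ℚₚ.≤-trans
    (ℚₚ.*-monoʳ-≤-nonNeg r {{Q.nonNegative 0≤r}} p≤q)
    (ℚₚ.*-monoˡ-≤-nonNeg q {{Q.nonNegative 0≤q}} r≤s)

  *-monoˡ-< : ∀ {p q r} → 0ℚ < r → p < q → r * p < r * q
  *-monoˡ-< {p} {q} {r} 0<r p<q = ℚₚ.*-monoʳ-<-pos r {{Q.positive 0<r}} p<q

  p≤∣p∣ : ∀ p → p ≤ ∣ p ∣
  p≤∣p∣ p with ℚₚ.≤-total 0ℚ p
  ... | inj₁ 0≤p = ℚₚ.≤-reflexive (sym (ℚₚ.0≤p⇒∣p∣≡p 0≤p))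
  ... | inj₂ p≤0 = ℚₚ.≤-trans p≤0 (ℚₚ.0≤∣p∣ p)

  ∣-∣-comm : ∀ p q → ∣ p - q ∣ ≡ ∣ q - p ∣
  ∣-∣-comm p q = trans (sym (ℚₚ.∣-p∣≡∣p∣ (p - q)))
    (cong ∣_∣ (solve 2 (λ p q → :- (p :- q) := q :- p) refl p q))

  ∣-∣-triangle : ∀ p q r → ∣ p - r ∣ ≤ ∣ p - q ∣ + ∣ q - r ∣
  ∣-∣-triangle p q r = subst (λ t → ∣ t ∣ ≤ ∣ p - q ∣ + ∣ q - r ∣)
    (solve 3 (λ p q r → (p :- q) :+ (q :- r) := p :- r) refl p q r)
    (ℚₚ.∣p+q∣≤∣p∣+∣q∣ (p - q) (q - r))

  0≤sq : ∀ p → 0ℚ ≤ p * p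
  0≤sq p with ℚₚ.≤-total 0ℚ p
  ... | inj₁ 0≤p = *-nonNeg 0≤p 0≤p
  ... | inj₂ p≤0 = subst (0ℚ ≤_)
    (solve 1 (λ p → (:- p) :* (:- p) := p :* p) refl p)
    (*-nonNeg (ℚₚ.neg-antimono-≤ p≤0) (ℚₚ.neg-antimono-≤ p≤0))

  0<½ : 0ℚ < ½
  0<½ = ℚₚ.positive⁻¹ ½

  0<1 : 0ℚ < 1ℚ
  0<1 = ℚₚ.positive⁻¹ 1ℚ

  half : ℚ → ℚ
  half ε = ½ * ε

  half-pos : ∀ {ε} → 0ℚ < ε → 0ℚ < half ε
  half-pos = *-pos 0<½

  half+half : ∀ ε → half ε + half ε ≡ ε
  half+half ε = trans (sym (ℚₚ.*-distribʳ-+ ε ½ ½)) (ℚₚ.*-identityˡ ε)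

  shrink : ∀ {C ε} → 0ℚ < C → 0ℚ < ε → ∃ λ δ → 0ℚ < δ × C * δ ≡ ε
  shrink {C} {ε} 0<C 0<ε = 1/C * ε , *-pos 0<1/C 0<ε ,
    trans (sym (ℚₚ.*-assoc C 1/C ε))
      (trans (cong (_* ε) (ℚₚ.*-inverseʳ C)) (ℚₚ.*-identityˡ ε))
    where
    instance
      C-pos : Positive C
      C-pos = Q.positive 0<C
      C-nz : Q.NonZero C
      C-nz = ℚₚ.pos⇒nonZero C
    1/C = Q.1/ C
    0<1/C = ℚₚ.positive⁻¹ 1/C {{ℚₚ.1/pos⇒pos C}}

  triangle-½ : ∀ {p q r ε} → ∣ p - q ∣ < half ε → ∣ q - r ∣ < half ε → ∣ p - r ∣ < ε
  triangle-½ {p} {q} {r} {ε} h₁ h₂ = ℚₚ.≤-<-trans (∣-∣-triangle p q r)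
    (subst (∣ p - q ∣ + ∣ q - r ∣ <_) (half+half ε) (ℚₚ.+-mono-< h₁ h₂))

  +-close : ∀ {a b c d ε} → ∣ a - b ∣ < half ε → ∣ c - d ∣ < half ε →
            ∣ (a + c) - (b + d) ∣ < ε
  +-close {a} {b} {c} {d} {ε} h₁ h₂ = ℚₚ.≤-<-trans
    (subst (λ t → ∣ t ∣ ≤ ∣ a - b ∣ + ∣ c - d ∣)
      (solve 4 (λ a b c d → (a :- b) :+ (c :- d) := (a :+ c) :- (b :+ d)) refl a b c d)
      (ℚₚ.∣p+q∣≤∣p∣+∣q∣ (a - b) (c - d)))
    (subst (∣ a - b ∣ + ∣ c - d ∣ <_) (half+half ε) (ℚₚ.+-mono-< h₁ h₂))

  neg-close : ∀ {a b ε} → ∣ a - b ∣ < ε → ∣ (- a) - (- b) ∣ < ε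
  neg-close {a} {b} {ε} h = subst (_< ε) (trans (∣-∣-comm a b) (cong ∣_∣
    (solve 2 (λ a b → b :- a := (:- a) :- (:- b)) refl a b))) h

  *-close : ∀ {a b c d C δ ε} → 0ℚ < C → C * δ ≡ half ε →
            ∣ a ∣ ≤ C → ∣ d ∣ ≤ C → ∣ a - b ∣ < δ → ∣ c - d ∣ < δ →
            ∣ a * c - b * d ∣ < ε
  *-close {a} {b} {c} {d} {C} {δ} {ε} 0<C Cδ a≤C d≤C ab cd = begin-strict
    ∣ a * c - b * d ∣
      ≡⟨ cong ∣_∣ (solve 4 (λ a b c d →
           a :* c :- b :* d := a :* (c :- d) :+ d :* (a :- b)) refl a b c d) ⟩
    ∣ a * (c - d) + d * (a - b) ∣
      ≤⟨ ℚₚ.∣p+q∣≤∣p∣+∣q∣ (a * (c - d)) (d * (a - b)) ⟩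
    ∣ a * (c - d) ∣ + ∣ d * (a - b) ∣
      ≡⟨ cong₂ _+_ (ℚₚ.∣p*q∣≡∣p∣*∣q∣ a (c - d)) (ℚₚ.∣p*q∣≡∣p∣*∣q∣ d (a - b)) ⟩
    ∣ a ∣ * ∣ c - d ∣ + ∣ d ∣ * ∣ a - b ∣
      ≤⟨ ℚₚ.+-mono-≤ (*-mono-≤ (ℚₚ.0≤∣p∣ (c - d)) 0≤C a≤C ℚₚ.≤-refl)
                     (*-mono-≤ (ℚₚ.0≤∣p∣ (a - b)) 0≤C d≤C ℚₚ.≤-refl) ⟩
    C * ∣ c - d ∣ + C * ∣ a - b ∣
      <⟨ ℚₚ.+-mono-< (*-monoˡ-< 0<C cd) (*-monoˡ-< 0<C ab) ⟩
    C * δ + C * δ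
      ≡⟨ trans (cong₂ _+_ Cδ Cδ) (half+half ε) ⟩
    ε ∎
    where
    open ℚₚ.≤-Reasoning
    0≤C = ℚₚ.<⇒≤ 0<C

  -- The reciprocal, with the junk value 0 at 0; `_⁻¹ᵣ` uses it only
  -- where the sequence is bounded away from 0.
  recip : ℚ → ℚ
  recip q with q ℚₚ.≟ 0ℚ
  ... | yes _  = 0ℚ
  ... | no q≢0 = (Q.1/ q) {{Q.≢-nonZero q≢0}}

  recip-inverse : ∀ {q} → 0ℚ < q → q * recip q ≡ 1ℚ
  recip-inverse {q} 0<q with q ℚₚ.≟ 0ℚ
  ... | yes q≡0 = contradiction (sym q≡0) (ℚₚ.<⇒≢ 0<q)
  ... | no q≢0  = ℚₚ.*-inverseʳ q {{Q.≢-nonZero q≢0}}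

  recip-nonNeg : ∀ {q} → 0ℚ < q → 0ℚ ≤ recip q
  recip-nonNeg {q} 0<q = ℚₚ.*-cancelˡ-≤-pos q {{Q.positive 0<q}}
    (subst₂ _≤_ (sym (ℚₚ.*-zeroʳ q)) (sym (recip-inverse 0<q)) (ℚₚ.<⇒≤ 0<1))

  recip-≤ : ∀ {η E q} → 0ℚ < η → η * E ≡ 1ℚ → η ≤ q → recip q ≤ E
  recip-≤ {η} {E} {q} 0<η ηE η≤q = ℚₚ.*-cancelˡ-≤-pos η {{Q.positive 0<η}}
    (ℚₚ.≤-trans
      (*-mono-≤ (recip-nonNeg 0<q) (ℚₚ.<⇒≤ 0<q) η≤q ℚₚ.≤-refl)
      (ℚₚ.≤-reflexive (trans (recip-inverse 0<q) (sym ηE))))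
    where 0<q = ℚₚ.<-≤-trans 0<η η≤q

  recip-close : ∀ {η E δ ε p q} → 0ℚ < η → 0ℚ < E → η * E ≡ 1ℚ → (E * E) * δ ≡ ε →
                η ≤ p → η ≤ q → ∣ p - q ∣ < δ → ∣ recip p - recip q ∣ < ε
  recip-close {η} {E} {δ} {ε} {p} {q} 0<η 0<E ηE EEδ η≤p η≤q pq = begin-strict
    ∣ rp - rq ∣
      ≡⟨ cong ∣_∣ rewriting ⟩
    ∣ (rp * rq) * (q - p) ∣
      ≡⟨ ℚₚ.∣p*q∣≡∣p∣*∣q∣ (rp * rq) (q - p) ⟩
    ∣ rp * rq ∣ * ∣ q - p ∣
      ≡⟨ cong₂ _*_ (ℚₚ.0≤p⇒∣p∣≡p (*-nonNeg 0≤rp 0≤rq)) (∣-∣-comm q p) ⟩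
    (rp * rq) * ∣ p - q ∣
      ≤⟨ *-mono-≤ (ℚₚ.0≤∣p∣ (p - q)) (*-nonNeg 0≤E 0≤E)
           (*-mono-≤ 0≤rq 0≤E (recip-≤ 0<η ηE η≤p) (recip-≤ 0<η ηE η≤q))
           ℚₚ.≤-refl ⟩
    (E * E) * ∣ p - q ∣
      <⟨ *-monoˡ-< (*-pos 0<E 0<E) pq ⟩
    (E * E) * δ
      ≡⟨ EEδ ⟩
    ε ∎
    where
    open ℚₚ.≤-Reasoning
    rp = recip p
    rq = recip q
    0<p = ℚₚ.<-≤-trans 0<η η≤p
    0<q = ℚₚ.<-≤-trans 0<η η≤q
    0≤rp = recip-nonNeg 0<p
    0≤rq = recip-nonNeg 0<q
    0≤E = ℚₚ.<⇒≤ 0<E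
    rewriting : rp - rq ≡ (rp * rq) * (q - p)
    rewriting = trans
      (cong₂ _-_
        (trans (sym (ℚₚ.*-identityʳ rp)) (cong (rp *_) (sym (recip-inverse 0<q))))
        (trans (sym (ℚₚ.*-identityʳ rq)) (cong (rq *_) (sym (recip-inverse 0<p)))))
      (solve 4 (λ p q rp rq →
        rp :* (q :* rq) :- rq :* (p :* rp) := (rp :* rq) :* (q :- p)) refl p q rp rq)

  sqrt-close : ∀ {a b ε} → 0ℚ ≤ a → 0ℚ ≤ b → 0ℚ < ε →
               ∣ a * a - b * b ∣ < ε * ε → ∣ a - b ∣ < ε
  sqrt-close {a} {b} {ε} 0≤a 0≤b 0<ε h = ℚₚ.≰⇒> λ ε≤d →
    ℚₚ.<-irrefl refl (ℚₚ.<-≤-trans h (begin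
      ε * ε                    ≤⟨ *-mono-≤ (ℚₚ.<⇒≤ 0<ε) (ℚₚ.0≤∣p∣ (a - b)) ε≤d ε≤d ⟩
      ∣ a - b ∣ * ∣ a - b ∣    ≤⟨ *-mono-≤ (ℚₚ.0≤∣p∣ (a - b)) (ℚₚ.0≤∣p∣ (a - b))
                                    ℚₚ.≤-refl d≤s ⟩
      ∣ a - b ∣ * ∣ a + b ∣    ≡⟨ sym (ℚₚ.∣p*q∣≡∣p∣*∣q∣ (a - b) (a + b)) ⟩
      ∣ (a - b) * (a + b) ∣    ≡⟨ cong ∣_∣ (solve 2 (λ a b →
                                    (a :- b) :* (a :+ b) := a :* a :- b :* b) refl a b) ⟩
      ∣ a * a - b * b ∣        ∎))
    where
    open ℚₚ.≤-Reasoning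
    d≤s : ∣ a - b ∣ ≤ ∣ a + b ∣
    d≤s = ℚₚ.≤-trans (ℚₚ.∣p-q∣≤∣p∣+∣q∣ a b) (ℚₚ.≤-reflexive
      (trans (cong₂ _+_ (ℚₚ.0≤p⇒∣p∣≡p 0≤a) (ℚₚ.0≤p⇒∣p∣≡p 0≤b))
             (sym (ℚₚ.0≤p⇒∣p∣≡p (+-nonNeg 0≤a 0≤b)))))

  halves : ℕ → ℚ
  halves zero    = 1ℚ
  halves (suc n) = ½ * halves n

  fromℕ : ℕ → ℚ
  fromℕ zero    = 0ℚ
  fromℕ (suc n) = 1ℚ + fromℕ n

  toℚᵘ-fromℕ : ∀ n → Q.toℚᵘ (fromℕ n) Qᵘ.≃ Qᵘ.mkℚᵘ (Z.+ n) 0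
  toℚᵘ-fromℕ zero    = Qᵘ.*≡* refl
  toℚᵘ-fromℕ (suc n) = ℚᵘₚ.≃-trans (ℚₚ.toℚᵘ-homo-+ 1ℚ (fromℕ n))
    (ℚᵘₚ.≃-trans (ℚᵘₚ.+-congʳ (Q.toℚᵘ 1ℚ) (toℚᵘ-fromℕ n))
      (Qᵘ.*≡* (cong (Z._* (Z.+ 1)) (cong (Z._+_ (Z.+ 1)) (ℤₚ.*-identityʳ (Z.+ n))))))

  archimedean : ∀ {δ} → 0ℚ < δ → ∃ λ N → 1ℚ ≤ fromℕ N * δ
  archimedean {δ@(mkℚ (Z.+ suc a) d _)} _ = suc d , ℚₚ.toℚᵘ-cancel-≤
    (ℚᵘₚ.≤-respʳ-≃ (ℚᵘₚ.≃-sym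
        (ℚᵘₚ.≃-trans (ℚₚ.toℚᵘ-homo-* (fromℕ (suc d)) δ)
          (ℚᵘₚ.*-congʳ {Q.toℚᵘ δ} (toℚᵘ-fromℕ (suc d)))))
      (Qᵘ.*≤* (Z.+≤+ lemma)))
    where
    lemma : suc (d N.+ 0 N.+ 0) N.≤ (suc d N.* suc a) N.* 1
    lemma = subst₂ N._≤_
      (cong suc (sym (trans (ℕₚ.+-identityʳ (d N.+ 0)) (ℕₚ.+-identityʳ d))))
      (sym (ℕₚ.*-identityʳ (suc d N.* suc a)))
      (ℕₚ.m≤m*n (suc d) (suc a))
  archimedean {mkℚ (Z.+ zero) d _}  0<δ = contradiction (ℚₚ.drop-*<* 0<δ) λ { (Z.+<+ ()) }
  archimedean {mkℚ -[1+ a ] d _} 0<δ = contradiction (ℚₚ.drop-*<* 0<δ) λ ()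

  halves-pos : ∀ n → 0ℚ < halves n
  halves-pos zero    = 0<1
  halves-pos (suc n) = half-pos (halves-pos n)

  ½≤1 : ½ ≤ 1ℚ
  ½≤1 = Q.*≤* (Z.+≤+ (N.s≤s N.z≤n))

  halves-≤1 : ∀ n → halves n ≤ 1ℚ
  halves-≤1 zero    = ℚₚ.≤-refl
  halves-≤1 (suc n) = ℚₚ.≤-trans
    (*-mono-≤ {½} {1ℚ} (ℚₚ.<⇒≤ (halves-pos n)) (ℚₚ.<⇒≤ 0<1) ½≤1 (halves-≤1 n))
    (ℚₚ.≤-reflexive (ℚₚ.*-identityˡ 1ℚ))

  fromℕ-nonNeg : ∀ n → 0ℚ ≤ fromℕ n
  fromℕ-nonNeg zero    = ℚₚ.≤-refl
  fromℕ-nonNeg (suc n) = +-nonNeg (ℚₚ.<⇒≤ 0<1) (fromℕ-nonNeg n)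

  fromℕ-mono : ∀ {m n} → m N.≤ n → fromℕ m ≤ fromℕ n
  fromℕ-mono {n = n} N.z≤n = fromℕ-nonNeg n
  fromℕ-mono (N.s≤s m≤n)   = ℚₚ.+-monoʳ-≤ 1ℚ (fromℕ-mono m≤n)

  fromℕ*halves : ∀ n → fromℕ (suc n) * halves n ≤ 1ℚ
  fromℕ*halves zero    = ℚₚ.≤-refl
  fromℕ*halves (suc n) = begin
    (1ℚ + f) * (½ * h)
      ≡⟨ solve 3 (λ f h k → (con 1ℚ :+ f) :* (k :* h) := k :* h :+ k :* (f :* h)) refl f h ½ ⟩
    half h + half (f * h)
      ≤⟨ ℚₚ.+-mono-≤ (half-mono (halves-≤1 n)) (half-mono (fromℕ*halves n)) ⟩
    half 1ℚ + half 1ℚ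
      ≡⟨ half+half 1ℚ ⟩
    1ℚ ∎
    where
    open ℚₚ.≤-Reasoning
    f = fromℕ (suc n)
    h = halves n
    half-mono : ∀ {p q} → p ≤ q → half p ≤ half q
    half-mono = ℚₚ.*-monoˡ-≤-nonNeg ½

  halves→0 : ∀ {δ} → 0ℚ < δ → ∃ λ N → ∀ n → N N.≤ n → halves n < δ
  halves→0 {δ} 0<δ with archimedean 0<δ
  ... | N , 1≤Nδ = N , λ n N≤n → ℚₚ.≰⇒> λ δ≤h → ℚₚ.<-irrefl refl (begin-strict
    1ℚ                        ≤⟨ 1≤Nδ ⟩
    fromℕ N * δ               ≤⟨ ℚₚ.*-monoʳ-≤-nonNeg δ {{Q.nonNegative (ℚₚ.<⇒≤ 0<δ)}} (fromℕ-mono N≤n) ⟩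
    fromℕ n * δ               ≡⟨ sym (ℚₚ.+-identityˡ _) ⟩
    0ℚ + fromℕ n * δ          <⟨ ℚₚ.+-monoˡ-< (fromℕ n * δ) 0<δ ⟩
    δ + fromℕ n * δ           ≡⟨ solve 2 (λ δ f → δ :+ f :* δ := (con 1ℚ :+ f) :* δ) refl δ (fromℕ n) ⟩
    fromℕ (suc n) * δ         ≤⟨ ℚₚ.*-monoˡ-≤-nonNeg (fromℕ (suc n)) {{Q.nonNegative (fromℕ-nonNeg (suc n))}} δ≤h ⟩
    fromℕ (suc n) * halves n  ≤⟨ fromℕ*halves n ⟩
    1ℚ                        ∎)
    where open ℚₚ.≤-Reasoning

  width : ℚ → ℕ → ℚ
  width q n = halves n * (q + 1ℚ)

  -- Bisection: for q ≥ 0 the square root of q lies between sqrtLo q n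
  -- and sqrtLo q n + width q n.
  sqrtLo : ℚ → ℕ → ℚ
  sqrtLo q zero    = 0ℚ
  sqrtLo q (suc n) with (sqrtLo q n + width q (suc n)) * (sqrtLo q n + width q (suc n)) ℚₚ.≤? q
  ... | yes _ = sqrtLo q n + width q (suc n)
  ... | no  _ = sqrtLo q n

  module _ {q : ℚ} (0≤q : 0ℚ ≤ q) where
    0<q+1 : 0ℚ < q + 1ℚ
    0<q+1 = ℚₚ.+-mono-≤-< 0≤q 0<1

    width-nonNeg : ∀ n → 0ℚ ≤ width q n
    width-nonNeg n = *-nonNeg (ℚₚ.<⇒≤ (halves-pos n)) (ℚₚ.<⇒≤ 0<q+1)

    width-split : ∀ n → width q (suc n) + width q (suc n) ≡ width q n
    width-split n = trans
      (cong₂ _+_ (ℚₚ.*-assoc ½ (halves n) (q + 1ℚ)) (ℚₚ.*-assoc ½ (halves n) (q + 1ℚ)))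
      (half+half (width q n))

    sqrtLo-nonNeg : ∀ n → 0ℚ ≤ sqrtLo q n
    sqrtLo-nonNeg zero    = ℚₚ.≤-refl
    sqrtLo-nonNeg (suc n) with (sqrtLo q n + width q (suc n)) * (sqrtLo q n + width q (suc n)) ℚₚ.≤? q
    ... | yes _ = +-nonNeg (sqrtLo-nonNeg n) (width-nonNeg (suc n))
    ... | no  _ = sqrtLo-nonNeg n

    sqrtLo-lower : ∀ n → sqrtLo q n * sqrtLo q n ≤ q
    sqrtLo-lower zero    = 0≤q
    sqrtLo-lower (suc n) with (sqrtLo q n + width q (suc n)) * (sqrtLo q n + width q (suc n)) ℚₚ.≤? q
    ... | yes h = h
    ... | no  _ = sqrtLo-lower n

    sqrtLo-upper : ∀ n → q ≤ (sqrtLo q n + width q n) * (sqrtLo q n + width q n)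
    sqrtLo-upper zero = 0≤-⇒≤ (subst (0ℚ ≤_)
      (solve 1 (λ q → q :* q :+ (q :+ con 1ℚ) :=
        (con 0ℚ :+ con 1ℚ :* (q :+ con 1ℚ)) :* (con 0ℚ :+ con 1ℚ :* (q :+ con 1ℚ)) :- q) refl q)
      (+-nonNeg (0≤sq q) (ℚₚ.<⇒≤ 0<q+1)))
    sqrtLo-upper (suc n) with (sqrtLo q n + width q (suc n)) * (sqrtLo q n + width q (suc n)) ℚₚ.≤? q
    ... | yes _ = subst (λ t → q ≤ t * t)
      (trans (cong (sqrtLo q n +_) (sym (width-split n)))
             (sym (ℚₚ.+-assoc (sqrtLo q n) (width q (suc n)) (width q (suc n)))))
      (sqrtLo-upper n)
    ... | no ¬h = ℚₚ.<⇒≤ (ℚₚ.≰⇒> ¬h)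

    sqrtLo-≤ : ∀ n → sqrtLo q n ≤ q + 1ℚ
    sqrtLo-≤ n = 0≤-⇒≤ (subst (0ℚ ≤_)
      (solve 2 (λ q l → (q :- l :* l) :+ ((l :- con ½) :* (l :- con ½) :+ con (½ + ½ * ½)) :=
        (q :+ con 1ℚ) :- l) refl q l)
      (+-nonNeg (≤⇒0≤- (sqrtLo-lower n))
        (+-nonNeg (0≤sq (l - ½)) (ℚₚ.nonNegative⁻¹ (½ + ½ * ½)))))
      where l = sqrtLo q n

    sqrtLo-error : ∀ {C δ ε} → q + 1ℚ ≤ C → (C * (C + C + C)) * δ ≡ ε →
                   ∀ n → halves n < δ → ∣ sqrtLo q n * sqrtLo q n - q ∣ < ε
    sqrtLo-error {C} {δ} {ε} q+1≤C Cδ n h<δ = begin-strict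
      ∣ l * l - q ∣               ≡⟨ ∣-∣-comm (l * l) q ⟩
      ∣ q - l * l ∣               ≡⟨ ℚₚ.0≤p⇒∣p∣≡p (≤⇒0≤- (sqrtLo-lower n)) ⟩
      q - l * l                   ≤⟨ ℚₚ.+-monoˡ-≤ (- (l * l)) (sqrtLo-upper n) ⟩
      (l + w) * (l + w) - l * l   ≡⟨ solve 2 (λ l w → (l :+ w) :* (l :+ w) :- l :* l :=
                                       w :* (l :+ l :+ w)) refl l w ⟩
      w * (l + l + w)             ≤⟨ *-mono-≤ (+-nonNeg (+-nonNeg 0≤l 0≤l) 0≤w) (*-nonNeg 0≤h 0≤C)
                                       (*-mono-≤ (ℚₚ.<⇒≤ 0<q+1) 0≤h ℚₚ.≤-refl q+1≤C)
                                       (ℚₚ.+-mono-≤ (ℚₚ.+-mono-≤ l≤C l≤C) w≤C) ⟩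
      (h * C) * (C + C + C)       ≡⟨ solve 2 (λ h C → (h :* C) :* (C :+ C :+ C) :=
                                       (C :* (C :+ C :+ C)) :* h) refl h C ⟩
      (C * (C + C + C)) * h       <⟨ *-monoˡ-< (*-pos 0<C (ℚₚ.+-mono-< (ℚₚ.+-mono-< 0<C 0<C) 0<C)) h<δ ⟩
      (C * (C + C + C)) * δ       ≡⟨ Cδ ⟩
      ε                           ∎
      where
      open ℚₚ.≤-Reasoning
      l = sqrtLo q n
      w = width q n
      h = halves n
      0≤l = sqrtLo-nonNeg n
      0≤w = width-nonNeg n
      0≤h = ℚₚ.<⇒≤ (halves-pos n)
      0<C = ℚₚ.<-≤-trans 0<q+1 q+1≤C
      0≤C = ℚₚ.<⇒≤ 0<C
      l≤C = ℚₚ.≤-trans (sqrtLo-≤ n) q+1≤C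
      w≤C : w ≤ C
      w≤C = ℚₚ.≤-trans
        (*-mono-≤ (ℚₚ.<⇒≤ 0<q+1) (ℚₚ.<⇒≤ 0<1) (halves-≤1 n) q+1≤C)
        (ℚₚ.≤-reflexive (ℚₚ.*-identityˡ C))

  bound-by : ∀ p q → ∣ q - p ∣ < 1ℚ → ∣ q ∣ ≤ ∣ p ∣ + 1ℚ
  bound-by p q h = begin
    ∣ q ∣              ≡⟨ cong ∣_∣ (solve 2 (λ p q → q := p :+ (q :- p)) refl p q) ⟩
    ∣ p + (q - p) ∣    ≤⟨ ℚₚ.∣p+q∣≤∣p∣+∣q∣ p (q - p) ⟩
    ∣ p ∣ + ∣ q - p ∣  ≤⟨ ℚₚ.+-monoʳ-≤ ∣ p ∣ (ℚₚ.<⇒≤ h) ⟩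
    ∣ p ∣ + 1ℚ         ∎
    where open ℚₚ.≤-Reasoning

  0<∣p∣+1 : ∀ p → 0ℚ < ∣ p ∣ + 1ℚ
  0<∣p∣+1 p = ℚₚ.+-mono-≤-< (ℚₚ.0≤∣p∣ p) 0<1

  +-pos : ∀ p q → 0ℚ < p → 0ℚ < q → 0ℚ < p + q
  +-pos p q 0<p 0<q = ℚₚ.+-mono-< 0<p 0<q

  p≤p+q : ∀ p q → 0ℚ < q → p ≤ p + q
  p≤p+q p q 0<q = subst (_≤ p + q) (ℚₚ.+-identityʳ p) (ℚₚ.+-monoʳ-≤ p (ℚₚ.<⇒≤ 0<q))

  q≤p+q : ∀ p q → 0ℚ < p → q ≤ p + q
  q≤p+q p q 0<p = subst (_≤ p + q) (ℚₚ.+-identityˡ q) (ℚₚ.+-monoˡ-≤ q (ℚₚ.<⇒≤ 0<p))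

  C[C+C+C]-pos : ∀ C → 0ℚ < C → 0ℚ < C * (C + C + C)
  C[C+C+C]-pos C 0<C = *-pos 0<C (+-pos (C + C) C (+-pos C C 0<C 0<C) 0<C)

  gap-resp : ∀ p q η → 0ℚ + η ≤ p → ∣ p - q ∣ < half η → 0ℚ + half η ≤ q
  gap-resp p q η h g = 0≤-⇒≤ (subst (0ℚ ≤_)
    (solve 3 (λ p q e → (p :- (con 0ℚ :+ (e :+ e))) :+ (e :- (p :- q)) :=
                        q :- (con 0ℚ :+ e)) refl p q (half η))
    (+-nonNeg
      (≤⇒0≤- (subst (λ t → 0ℚ + t ≤ p) (sym (half+half η)) h))
      (≤⇒0≤- (ℚₚ.≤-trans (p≤∣p∣ (p - q)) (ℚₚ.<⇒≤ g)))))

  drop-0+ : ∀ {p q} → 0ℚ + p ≤ q → p ≤ q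
  drop-0+ {p} {q} = subst (_≤ q) (ℚₚ.+-identityˡ p)

  add-0+ : ∀ {p q} → p ≤ q → 0ℚ + p ≤ q
  add-0+ {p} {q} = subst (_≤ q) (sym (ℚₚ.+-identityˡ p))

  gap-* : ∀ p q η θ → 0ℚ < η → 0ℚ < θ → 0ℚ + η ≤ p → 0ℚ + θ ≤ q → 0ℚ + η * θ ≤ p * q
  gap-* p q η θ 0<η 0<θ h g = add-0+ {η * θ} {p * q}
    (*-mono-≤ {η} {p} {θ} {q} (ℚₚ.<⇒≤ 0<θ) (ℚₚ.≤-trans (ℚₚ.<⇒≤ 0<η) (drop-0+ {η} {p} h))
      (drop-0+ {η} {p} h) (drop-0+ {θ} {q} g))

  gap-cancel : ∀ p q C δ η → 0ℚ < C → C * δ ≡ η → 0ℚ ≤ p → 0ℚ ≤ q → ∣ q ∣ ≤ C →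
               0ℚ + η ≤ p * q → 0ℚ + δ ≤ p
  gap-cancel p q C δ η 0<C Cδ 0≤p 0≤q q≤C h =
    add-0+ {δ} {p} (ℚₚ.*-cancelˡ-≤-pos C {{Q.positive 0<C}} (begin
      C * δ     ≡⟨ Cδ ⟩
      η         ≤⟨ drop-0+ {η} {p * q} h ⟩
      p * q     ≤⟨ *-mono-≤ 0≤q 0≤p ℚₚ.≤-refl (ℚₚ.≤-trans (p≤∣p∣ q) q≤C) ⟩
      p * C     ≡⟨ ℚₚ.*-comm p C ⟩
      C * p     ∎))
    where open ℚₚ.≤-Reasoning

  square-gap : ∀ m η → 0ℚ ≤ m → 0ℚ < η → m + η ≤ 1ℚ → 0ℚ + η ≤ 1ℚ + - (m * m)
  square-gap m η 0≤m 0<η h = add-0+ {η} {1ℚ + - (m * m)} (0≤-⇒≤ (subst (0ℚ ≤_)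
    (solve 2 (λ m e → m :* (con 1ℚ :- m) :+ (con 1ℚ :- (m :+ e)) :=
                      (con 1ℚ :+ :- (m :* m)) :- e) refl m η)
    (+-nonNeg (*-nonNeg 0≤m (≤⇒0≤- (ℚₚ.≤-trans (p≤p+q m η 0<η) h))) (≤⇒0≤- h))))

  normSq-gap : ∀ a b η → 0ℚ < η → 0ℚ + η ≤ 1ℚ + - (a * a + b * b) →
    0ℚ + η * η ≤ ((a * a + - (b * b)) + - 1ℚ) * ((a * a + - (b * b)) + - 1ℚ) +
                 ((a * b + b * a) + - 0ℚ) * ((a * b + b * a) + - 0ℚ)
  normSq-gap a b η 0<η h = add-0+ {η * η} (begin
    η * η
      ≤⟨ *-mono-≤ (ℚₚ.<⇒≤ 0<η) (ℚₚ.≤-trans (ℚₚ.<⇒≤ 0<η) η≤s) η≤s η≤s ⟩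
    s * s
      ≡⟨ sym (ℚₚ.+-identityʳ (s * s)) ⟩
    s * s + 0ℚ
      ≤⟨ ℚₚ.+-monoʳ-≤ (s * s) (0≤sq t) ⟩
    s * s + t * t
      ≡⟨ cong (_+ t * t) (solve 2 (λ a b →
           (con 1ℚ :- (a :* a :- b :* b)) :* (con 1ℚ :- (a :* a :- b :* b)) :=
           ((a :* a :+ :- (b :* b)) :+ :- (con 1ℚ)) :*
           ((a :* a :+ :- (b :* b)) :+ :- (con 1ℚ))) refl a b) ⟩
    ((a * a + - (b * b)) + - 1ℚ) * ((a * a + - (b * b)) + - 1ℚ) + t * t ∎)
    where
    open ℚₚ.≤-Reasoning
    s = 1ℚ - (a * a - b * b)
    t = (a * b + b * a) + - 0ℚ
    η≤s : η ≤ s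
    η≤s = ℚₚ.≤-trans (drop-0+ {η} {1ℚ + - (a * a + b * b)} h) (0≤-⇒≤ (subst (0ℚ ≤_)
      (solve 2 (λ a b → b :* b :+ b :* b :=
        (con 1ℚ :- (a :* a :- b :* b)) :- (con 1ℚ :+ :- (a :* a :+ b :* b))) refl a b)
      (+-nonNeg (0≤sq b) (0≤sq b))))

-- Cauchy sequences of rationals, so that the operations are termwise;
-- _≈ᵣ_ (difference tends to 0) is the equality of reals.
record ℝ : Set where
  no-eta-equality
  field
    seq    : ℕ → ℚ
    cauchy : ∀ ε → 0ℚ Q.< ε → ∃ λ N → ∀ m n → N N.≤ m → N N.≤ n →
             Q.∣ seq m Q.- seq n ∣ Q.< ε
open ℝ

infix 4 _≈ᵣ_ _<ᵣ_
infixl 6 _+ᵣ_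
infixl 7 _*ᵣ_
infix 8 -ᵣ_

record _≈ᵣ_ (x y : ℝ) : Set where
  constructor null
  field
    close : ∀ ε → 0ℚ Q.< ε → ∃ λ N → ∀ n → N N.≤ n → Q.∣ seq x n Q.- seq y n ∣ Q.< ε
open _≈ᵣ_

-- A positive rational gap is part of the data, so x <ᵣ y is a strict
-- inequality between the limits and not just between the terms.
_<ᵣ_ : ℝ → ℝ → Set
x <ᵣ y = ∃ λ ε → 0ℚ Q.< ε × ∃ λ N → ∀ n → N N.≤ n → seq x n Q.+ ε Q.≤ seq y n

fromℚ : ℚ → ℝ
fromℚ q .seq _ = q
fromℚ q .cauchy ε 0<ε = 0 , λ _ _ _ _ →
  subst (λ t → Q.∣ t ∣ Q.< ε) (sym (ℚₚ.+-inverseʳ q)) 0<ε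

0ᵣ 1ᵣ : ℝ
0ᵣ = fromℚ 0ℚ
1ᵣ = fromℚ 1ℚ

private
  ⊔ˡ : ∀ {m n o} → m N.⊔ n N.≤ o → m N.≤ o
  ⊔ˡ {m} {n} = ℕₚ.m⊔n≤o⇒m≤o m n

  ⊔ʳ : ∀ {m n o} → m N.⊔ n N.≤ o → n N.≤ o
  ⊔ʳ {m} {n} = ℕₚ.m⊔n≤o⇒n≤o m n

bounded : ∀ x → ∃ λ C → 0ℚ Q.< C × ∃ λ N → ∀ n → N N.≤ n → Q.∣ seq x n ∣ Q.≤ C
bounded x = let N , h = cauchy x 1ℚ Rat.0<1 in
  Q.∣ seq x N ∣ Q.+ 1ℚ , Rat.0<∣p∣+1 (seq x N) , N , λ n N≤n →
  Rat.bound-by (seq x N) (seq x n) (h n N N≤n ℕₚ.≤-refl)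

bounded₂ : ∀ x y → ∃ λ C → 0ℚ Q.< C × ∃ λ N → ∀ n → N N.≤ n →
           Q.∣ seq x n ∣ Q.≤ C × Q.∣ seq y n ∣ Q.≤ C
bounded₂ x y =
  let C , 0<C , M , hx = bounded x
      D , 0<D , N , hy = bounded y in
  C Q.+ D , Rat.+-pos C D 0<C 0<D , M N.⊔ N , λ n h →
    ℚₚ.≤-trans (hx n (⊔ˡ {M} {N} h)) (Rat.p≤p+q C D 0<D) ,
    ℚₚ.≤-trans (hy n (⊔ʳ {M} {N} h)) (Rat.q≤p+q C D 0<C)

_+ᵣ_ : ℝ → ℝ → ℝ
(x +ᵣ y) .seq n = seq x n Q.+ seq y n
(x +ᵣ y) .cauchy ε 0<ε =
    let M , hx = cauchy x (Rat.half ε) (Rat.half-pos 0<ε)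
        N , hy = cauchy y (Rat.half ε) (Rat.half-pos 0<ε) in
    M N.⊔ N , λ m n p q → Rat.+-close {seq x m} {seq x n} {seq y m} {seq y n} {ε}
      (hx m n (⊔ˡ {M} {N} p) (⊔ˡ {M} {N} q)) (hy m n (⊔ʳ {M} {N} p) (⊔ʳ {M} {N} q))

-ᵣ_ : ℝ → ℝ
(-ᵣ x) .seq n = Q.- seq x n
(-ᵣ x) .cauchy ε 0<ε = let N , h = cauchy x ε 0<ε in
  N , λ m n p q → Rat.neg-close {seq x m} {seq x n} {ε} (h m n p q)

_*ᵣ_ : ℝ → ℝ → ℝ
(x *ᵣ y) .seq n = seq x n Q.* seq y n
(x *ᵣ y) .cauchy ε 0<ε =
    let C , 0<C , L , b = bounded₂ x y
        δ , 0<δ , Cδ    = Rat.shrink {C} {Rat.half ε} 0<C (Rat.half-pos 0<ε)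
        M , hx          = cauchy x δ 0<δ
        N , hy          = cauchy y δ 0<δ in
    L N.⊔ (M N.⊔ N) , λ m n p q →
    Rat.*-close {seq x m} {seq x n} {seq y m} {seq y n} {C} {δ} {ε} 0<C Cδ
      (proj₁ (b m (⊔ˡ {L} p))) (proj₂ (b n (⊔ˡ {L} q)))
      (hx m n (⊔ˡ {M} {N} (⊔ʳ {L} p)) (⊔ˡ {M} {N} (⊔ʳ {L} q)))
      (hy m n (⊔ʳ {M} {N} (⊔ʳ {L} p)) (⊔ʳ {M} {N} (⊔ʳ {L} q)))

≗⇒≈ᵣ : ∀ {x y} → (∀ n → seq x n ≡ seq y n) → x ≈ᵣ y
≗⇒≈ᵣ {x} {y} h = null λ ε 0<ε → 0 , λ n _ → subst (λ t → Q.∣ t ∣ Q.< ε)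
  (sym (trans (cong (Q._- seq y n) (h n)) (ℚₚ.+-inverseʳ (seq y n)))) 0<ε

≈ᵣ-sym : ∀ {x y} → x ≈ᵣ y → y ≈ᵣ x
≈ᵣ-sym {x} {y} h = null λ ε 0<ε → let N , g = close h ε 0<ε in
  N , λ n p → subst (Q._< ε) (Rat.∣-∣-comm (seq x n) (seq y n)) (g n p)

≈ᵣ-trans : ∀ {x y z} → x ≈ᵣ y → y ≈ᵣ z → x ≈ᵣ z
≈ᵣ-trans {x} {y} {z} h k = null λ ε 0<ε →
  let M , f = close h (Rat.half ε) (Rat.half-pos 0<ε)
      N , g = close k (Rat.half ε) (Rat.half-pos 0<ε) in
  M N.⊔ N , λ n p → Rat.triangle-½ {seq x n} {seq y n} {seq z n} {ε}
    (f n (⊔ˡ {M} {N} p)) (g n (⊔ʳ {M} {N} p))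

+ᵣ-cong : ∀ {x y u v} → x ≈ᵣ y → u ≈ᵣ v → x +ᵣ u ≈ᵣ y +ᵣ v
+ᵣ-cong {x} {y} {u} {v} h k = null λ ε 0<ε →
  let M , f = close h (Rat.half ε) (Rat.half-pos 0<ε)
      N , g = close k (Rat.half ε) (Rat.half-pos 0<ε) in
  M N.⊔ N , λ n p → Rat.+-close {seq x n} {seq y n} {seq u n} {seq v n} {ε}
    (f n (⊔ˡ {M} {N} p)) (g n (⊔ʳ {M} {N} p))

-ᵣ-cong : ∀ {x y} → x ≈ᵣ y → -ᵣ x ≈ᵣ -ᵣ y
-ᵣ-cong {x} {y} h = null λ ε 0<ε → let N , f = close h ε 0<ε in
  N , λ n p → Rat.neg-close {seq x n} {seq y n} {ε} (f n p)

*ᵣ-cong : ∀ {x y u v} → x ≈ᵣ y → u ≈ᵣ v → x *ᵣ u ≈ᵣ y *ᵣ v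
*ᵣ-cong {x} {y} {u} {v} h k = null λ ε 0<ε →
  let C , 0<C , L , b = bounded₂ x v
      δ , 0<δ , Cδ    = Rat.shrink {C} {Rat.half ε} 0<C (Rat.half-pos 0<ε)
      M , f           = close h δ 0<δ
      N , g           = close k δ 0<δ in
  L N.⊔ (M N.⊔ N) , λ n p →
  Rat.*-close {seq x n} {seq y n} {seq u n} {seq v n} {C} {δ} {ε} 0<C Cδ
    (proj₁ (b n (⊔ˡ {L} p))) (proj₂ (b n (⊔ˡ {L} p)))
    (f n (⊔ˡ {M} {N} (⊔ʳ {L} p))) (g n (⊔ʳ {M} {N} (⊔ʳ {L} p)))

ℝ-commutativeRing : CommutativeRing 0ℓ 0ℓ
ℝ-commutativeRing = record
  { Carrier = ℝ
  ; _≈_ = _≈ᵣ_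
  ; _+_ = _+ᵣ_
  ; _*_ = _*ᵣ_
  ; -_  = -ᵣ_
  ; 0#  = 0ᵣ
  ; 1#  = 1ᵣ
  ; isCommutativeRing = record
    { isRing = record
      { +-isAbelianGroup = record
        { isGroup = record
          { isMonoid = record
            { isSemigroup = record
              { isMagma = record
                { isEquivalence = record
                  { refl  = ≗⇒≈ᵣ λ _ → refl
                  ; sym   = ≈ᵣ-sym
                  ; trans = ≈ᵣ-trans
                  }
                ; ∙-cong = +ᵣ-cong
                }
              ; assoc = λ x y z → ≗⇒≈ᵣ {(x +ᵣ y) +ᵣ z} {x +ᵣ (y +ᵣ z)}
                  λ n → ℚₚ.+-assoc (seq x n) (seq y n) (seq z n)
              }
            ; identity =
                (λ x → ≗⇒≈ᵣ {0ᵣ +ᵣ x} {x} λ n → ℚₚ.+-identityˡ (seq x n)) ,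
                (λ x → ≗⇒≈ᵣ {x +ᵣ 0ᵣ} {x} λ n → ℚₚ.+-identityʳ (seq x n))
            }
          ; inverse =
              (λ x → ≗⇒≈ᵣ {(-ᵣ x) +ᵣ x} {0ᵣ} λ n → ℚₚ.+-inverseˡ (seq x n)) ,
              (λ x → ≗⇒≈ᵣ {x +ᵣ (-ᵣ x)} {0ᵣ} λ n → ℚₚ.+-inverseʳ (seq x n))
          ; ⁻¹-cong = -ᵣ-cong
          }
        ; comm = λ x y → ≗⇒≈ᵣ {x +ᵣ y} {y +ᵣ x} λ n → ℚₚ.+-comm (seq x n) (seq y n)
        }
      ; *-cong = *ᵣ-cong
      ; *-assoc = λ x y z → ≗⇒≈ᵣ {(x *ᵣ y) *ᵣ z} {x *ᵣ (y *ᵣ z)}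
          λ n → ℚₚ.*-assoc (seq x n) (seq y n) (seq z n)
      ; *-identity =
          (λ x → ≗⇒≈ᵣ {1ᵣ *ᵣ x} {x} λ n → ℚₚ.*-identityˡ (seq x n)) ,
          (λ x → ≗⇒≈ᵣ {x *ᵣ 1ᵣ} {x} λ n → ℚₚ.*-identityʳ (seq x n))
      ; distrib =
          (λ x y z → ≗⇒≈ᵣ {x *ᵣ (y +ᵣ z)} {x *ᵣ y +ᵣ x *ᵣ z}
            λ n → ℚₚ.*-distribˡ-+ (seq x n) (seq y n) (seq z n)) ,
          (λ x y z → ≗⇒≈ᵣ {(y +ᵣ z) *ᵣ x} {y *ᵣ x +ᵣ z *ᵣ x}
            λ n → ℚₚ.*-distribʳ-+ (seq x n) (seq y n) (seq z n))
      }
    ; *-comm = λ x y → ≗⇒≈ᵣ {x *ᵣ y} {y *ᵣ x} λ n → ℚₚ.*-comm (seq x n) (seq y n)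
    }
  }

module ℝR = CommutativeRing ℝ-commutativeRing

_⁻¹ᵣ : (x : ℝ) → {0ᵣ <ᵣ x} → ℝ
(x ⁻¹ᵣ) .seq n = Rat.recip (seq x n)
(_⁻¹ᵣ x {η , 0<η , L , 0+η≤x}) .cauchy ε 0<ε =
    let E , 0<E , ηE  = Rat.shrink {η} {1ℚ} 0<η Rat.0<1
        δ , 0<δ , EEδ = Rat.shrink {E Q.* E} {ε} (Rat.*-pos {E} {E} 0<E 0<E) 0<ε
        N , h         = cauchy x δ 0<δ in
    L N.⊔ N , λ m n p q →
    Rat.recip-close {η} {E} {δ} {ε} {seq x m} {seq x n} 0<η 0<E ηE EEδ
      (Rat.drop-0+ {η} {seq x m} (0+η≤x m (⊔ˡ {L} {N} p)))
      (Rat.drop-0+ {η} {seq x n} (0+η≤x n (⊔ˡ {L} {N} q)))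
      (h m n (⊔ʳ {L} {N} p) (⊔ʳ {L} {N} q))

*ᵣ-inverseʳ : ∀ x (0<x : 0ᵣ <ᵣ x) → x *ᵣ (x ⁻¹ᵣ) {0<x} ≈ᵣ 1ᵣ
*ᵣ-inverseʳ x (η , 0<η , L , 0+η≤x) = null λ ε 0<ε → L , λ n p → subst (λ t → Q.∣ t ∣ Q.< ε)
  (sym (trans
    (cong (Q._- 1ℚ) (Rat.recip-inverse
      (ℚₚ.<-≤-trans (subst (0ℚ Q.<_) (sym (ℚₚ.+-identityˡ η)) 0<η) (0+η≤x n p))))
    (ℚₚ.+-inverseʳ 1ℚ))) 0<ε

-- Pointwise nonnegativity of the representing sequence; sums of squares
-- satisfy it on the nose.
NonNegᵣ : ℝ → Set
NonNegᵣ x = ∀ n → 0ℚ Q.≤ seq x n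

private
  sqrt-error : ∀ x → NonNegᵣ x → ∀ ε → 0ℚ Q.< ε → ∃ λ N → ∀ n → N N.≤ n →
    Q.∣ Rat.sqrtLo (seq x n) n Q.* Rat.sqrtLo (seq x n) n Q.- seq x n ∣ Q.< ε
  sqrt-error x 0≤x ε 0<ε =
    let B , 0<B , M , b = bounded x
        C               = B Q.+ 1ℚ
        δ , 0<δ , Kδ    = Rat.shrink {C Q.* (C Q.+ C Q.+ C)} {ε}
                            (Rat.C[C+C+C]-pos C (Rat.+-pos B 1ℚ 0<B Rat.0<1)) 0<ε
        N , h           = Rat.halves→0 {δ} 0<δ in
    M N.⊔ N , λ n p → Rat.sqrtLo-error {seq x n} (0≤x n) {C} {δ} {ε}
      (ℚₚ.+-monoˡ-≤ 1ℚ (ℚₚ.≤-trans (Rat.p≤∣p∣ (seq x n)) (b n (⊔ˡ {M} {N} p))))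
      Kδ n (h n (⊔ʳ {M} {N} p))

sqrtᵣ : (x : ℝ) → NonNegᵣ x → ℝ
sqrtᵣ x 0≤x .seq n = Rat.sqrtLo (seq x n) n
sqrtᵣ x 0≤x .cauchy ε 0<ε =
    let s : ℕ → ℚ
        s n   = Rat.sqrtLo (seq x n) n
        η     = ε Q.* ε
        0<½η  = Rat.half-pos {η} (Rat.*-pos {ε} {ε} 0<ε 0<ε)
        0<¼η  = Rat.half-pos {Rat.half η} 0<½η
        L , e = sqrt-error x 0≤x (Rat.half η) 0<½η
        M , f = sqrt-error x 0≤x (Rat.half (Rat.half η)) 0<¼η
        N , g = cauchy x (Rat.half (Rat.half η)) 0<¼η in
    L N.⊔ (M N.⊔ N) , λ m n p q →
    Rat.sqrt-close {s m} {s n} {ε}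
      (Rat.sqrtLo-nonNeg {seq x m} (0≤x m) m) (Rat.sqrtLo-nonNeg {seq x n} (0≤x n) n) 0<ε
      (Rat.triangle-½ {s m Q.* s m} {seq x m} {s n Q.* s n} {η} (e m (⊔ˡ {L} p))
        (Rat.triangle-½ {seq x m} {seq x n} {s n Q.* s n} {Rat.half η}
          (g m n (⊔ʳ {M} {N} (⊔ʳ {L} p)) (⊔ʳ {M} {N} (⊔ʳ {L} q)))
          (subst (Q._< Rat.half (Rat.half η)) (Rat.∣-∣-comm (s n Q.* s n) (seq x n))
            (f n (⊔ˡ {M} {N} (⊔ʳ {L} q))))))

sqrtᵣ-nonNeg : ∀ x (0≤x : NonNegᵣ x) → NonNegᵣ (sqrtᵣ x 0≤x)
sqrtᵣ-nonNeg x 0≤x n = Rat.sqrtLo-nonNeg (0≤x n) n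

sqrtᵣ-square : ∀ x (0≤x : NonNegᵣ x) → sqrtᵣ x 0≤x *ᵣ sqrtᵣ x 0≤x ≈ᵣ x
sqrtᵣ-square x 0≤x = null (sqrt-error x 0≤x)

0<-resp-≈ᵣ : ∀ {x y} → x ≈ᵣ y → 0ᵣ <ᵣ x → 0ᵣ <ᵣ y
0<-resp-≈ᵣ {x} {y} x≈y (η , 0<η , M , h) =
  let N , g = close x≈y (Rat.half η) (Rat.half-pos {η} 0<η) in
  Rat.half η , Rat.half-pos {η} 0<η , M N.⊔ N , λ n p →
  Rat.gap-resp (seq x n) (seq y n) η (h n (⊔ˡ {M} {N} p)) (g n (⊔ʳ {M} {N} p))

0<-* : ∀ {x y} → 0ᵣ <ᵣ x → 0ᵣ <ᵣ y → 0ᵣ <ᵣ x *ᵣ y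
0<-* {x} {y} (η , 0<η , M , h) (θ , 0<θ , N , g) =
  η Q.* θ , Rat.*-pos {η} {θ} 0<η 0<θ , M N.⊔ N , λ n p →
  Rat.gap-* (seq x n) (seq y n) η θ 0<η 0<θ (h n (⊔ˡ {M} {N} p)) (g n (⊔ʳ {M} {N} p))

0<-*-cancel : ∀ {x y} → NonNegᵣ x → NonNegᵣ y → 0ᵣ <ᵣ x *ᵣ y → 0ᵣ <ᵣ x
0<-*-cancel {x} {y} 0≤x 0≤y (η , 0<η , M , h) =
  let C , 0<C , N , b = bounded y
      δ , 0<δ , Cδ    = Rat.shrink {C} {η} 0<C 0<η in
  δ , 0<δ , M N.⊔ N , λ n p →
  Rat.gap-cancel (seq x n) (seq y n) C δ η 0<C Cδ (0≤x n) (0≤y n)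
    (b n (⊔ʳ {M} {N} p)) (h n (⊔ˡ {M} {N} p))

record ℂ : Set where
  no-eta-equality
  constructor _+i_
  field
    re im : ℝ
open ℂ

infix 4 _≈_ _≠0
infixl 6 _+_ _-_
infixl 7 _*_ _/_[_]
infix 8 -_
infix 9 _⁻¹[_]

record _≈_ (z w : ℂ) : Set where
  constructor _,_
  field
    re≈ : re z ≈ᵣ re w
    im≈ : im z ≈ᵣ im w
open _≈_

0ℂ 1ℂ : ℂ
0ℂ = 0ᵣ +i 0ᵣ
1ℂ = 1ᵣ +i 0ᵣ

_+_ : ℂ → ℂ → ℂ
(z + w) .re = re z +ᵣ re w
(z + w) .im = im z +ᵣ im w

-_ : ℂ → ℂ
(- z) .re = -ᵣ re z
(- z) .im = -ᵣ im z

_-_ : ℂ → ℂ → ℂ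
z - w = z + (- w)

_*_ : ℂ → ℂ → ℂ
(z * w) .re = re z *ᵣ re w +ᵣ -ᵣ (im z *ᵣ im w)
(z * w) .im = re z *ᵣ im w +ᵣ im z *ᵣ re w

≈-refl : ∀ {z} → z ≈ z
≈-refl = ℝR.refl , ℝR.refl

≈-sym : ∀ {z w} → z ≈ w → w ≈ z
≈-sym (p , q) = ℝR.sym p , ℝR.sym q

≈-trans : ∀ {z w v} → z ≈ w → w ≈ v → z ≈ v
≈-trans (p , q) (r , s) = ℝR.trans p r , ℝR.trans q s

*-cong : ∀ {z w u v} → z ≈ w → u ≈ v → z * u ≈ w * v
*-cong (p , q) (r , s) =
  ℝR.+-cong (ℝR.*-cong p r) (ℝR.-‿cong (ℝR.*-cong q s)) ,
  ℝR.+-cong (ℝR.*-cong p s) (ℝR.*-cong q r)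

module _ where
  open +-*-Solver using (solve; _:+_; _:*_; :-_; _:=_; con)

  *-assoc : ∀ z w v → (z * w) * v ≈ z * (w * v)
  *-assoc z w v =
    ≗⇒≈ᵣ (λ n → solve 6 (λ a b c d e f →
      (a :* c :+ :- (b :* d)) :* e :+ :- ((a :* d :+ b :* c) :* f) :=
      a :* (c :* e :+ :- (d :* f)) :+ :- (b :* (c :* f :+ d :* e))) refl
      (seq (re z) n) (seq (im z) n) (seq (re w) n) (seq (im w) n) (seq (re v) n) (seq (im v) n)) ,
    ≗⇒≈ᵣ (λ n → solve 6 (λ a b c d e f →
      (a :* c :+ :- (b :* d)) :* f :+ (a :* d :+ b :* c) :* e :=
      a :* (c :* f :+ d :* e) :+ b :* (c :* e :+ :- (d :* f))) refl
      (seq (re z) n) (seq (im z) n) (seq (re w) n) (seq (im w) n) (seq (re v) n) (seq (im v) n))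

  *-comm : ∀ z w → z * w ≈ w * z
  *-comm z w =
    ≗⇒≈ᵣ (λ n → solve 4 (λ a b c d →
      a :* c :+ :- (b :* d) := c :* a :+ :- (d :* b)) refl
      (seq (re z) n) (seq (im z) n) (seq (re w) n) (seq (im w) n)) ,
    ≗⇒≈ᵣ (λ n → solve 4 (λ a b c d →
      a :* d :+ b :* c := c :* b :+ d :* a) refl
      (seq (re z) n) (seq (im z) n) (seq (re w) n) (seq (im w) n))

  *-identityˡ : ∀ z → 1ℂ * z ≈ z
  *-identityˡ z =
    ≗⇒≈ᵣ (λ n → solve 2 (λ a b → con 1ℚ :* a :+ :- (con 0ℚ :* b) := a) refl
      (seq (re z) n) (seq (im z) n)) ,
    ≗⇒≈ᵣ (λ n → solve 2 (λ a b → con 1ℚ :* b :+ con 0ℚ :* a := b) refl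
      (seq (re z) n) (seq (im z) n))

  *-distribʳ-+ : ∀ z w v → (w + v) * z ≈ w * z + v * z
  *-distribʳ-+ z w v =
    ≗⇒≈ᵣ (λ n → solve 6 (λ a b c d e f →
      (c :+ e) :* a :+ :- ((d :+ f) :* b) :=
      (c :* a :+ :- (d :* b)) :+ (e :* a :+ :- (f :* b))) refl
      (seq (re z) n) (seq (im z) n) (seq (re w) n) (seq (im w) n) (seq (re v) n) (seq (im v) n)) ,
    ≗⇒≈ᵣ (λ n → solve 6 (λ a b c d e f →
      (c :+ e) :* b :+ (d :+ f) :* a := (c :* b :+ d :* a) :+ (e :* b :+ f :* a)) refl
      (seq (re z) n) (seq (im z) n) (seq (re w) n) (seq (im w) n) (seq (re v) n) (seq (im v) n))

ℂ-commutativeRing : CommutativeRing 0ℓ 0ℓ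
ℂ-commutativeRing = record
  { Carrier = ℂ
  ; _≈_ = _≈_
  ; _+_ = _+_
  ; _*_ = _*_
  ; -_  = -_
  ; 0#  = 0ℂ
  ; 1#  = 1ℂ
  ; isCommutativeRing = record
    { isRing = record
      { +-isAbelianGroup = record
        { isGroup = record
          { isMonoid = record
            { isSemigroup = record
              { isMagma = record
                { isEquivalence = record { refl = ≈-refl ; sym = ≈-sym ; trans = ≈-trans }
                ; ∙-cong = λ (p , q) (r , s) → ℝR.+-cong p r , ℝR.+-cong q s
                }
              ; assoc = λ z w v → ℝR.+-assoc (re z) (re w) (re v) , ℝR.+-assoc (im z) (im w) (im v)
              }
            ; identity =
                (λ z → ℝR.+-identityˡ (re z) , ℝR.+-identityˡ (im z)) ,
                (λ z → ℝR.+-identityʳ (re z) , ℝR.+-identityʳ (im z))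
            }
          ; inverse =
              (λ z → ℝR.-‿inverseˡ (re z) , ℝR.-‿inverseˡ (im z)) ,
              (λ z → ℝR.-‿inverseʳ (re z) , ℝR.-‿inverseʳ (im z))
          ; ⁻¹-cong = λ (p , q) → ℝR.-‿cong p , ℝR.-‿cong q
          }
        ; comm = λ z w → ℝR.+-comm (re z) (re w) , ℝR.+-comm (im z) (im w)
        }
      ; *-cong = *-cong
      ; *-assoc = *-assoc
      ; *-identity = *-identityˡ , λ z → ≈-trans (*-comm z 1ℂ) (*-identityˡ z)
      ; distrib =
          (λ z w v → ≈-trans (*-comm z (w + v)) (≈-trans (*-distribʳ-+ z w v)
            (let p , q = *-comm w z ; r , s = *-comm v z in ℝR.+-cong p r , ℝR.+-cong q s))) ,
          *-distribʳ-+
      }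
    ; *-comm = *-comm
    }
  }

module ℂR = CommutativeRing ℂ-commutativeRing

normSq : ℂ → ℝ
normSq z = re z *ᵣ re z +ᵣ im z *ᵣ im z

normSq-nonNeg : ∀ z → NonNegᵣ (normSq z)
normSq-nonNeg z n = Rat.+-nonNeg (Rat.0≤sq (seq (re z) n)) (Rat.0≤sq (seq (im z) n))

∣_∣ : ℂ → ℝ
∣ z ∣ = sqrtᵣ (normSq z) (normSq-nonNeg z)

-- Constructive non-vanishing: ∣ z ∣ is bounded away from 0, which is
-- what makes z invertible (classically it is just z ≢ 0).
_≠0 : ℂ → Set
z ≠0 = 0ᵣ <ᵣ ∣ z ∣

≠0⇒0<normSq : ∀ z → z ≠0 → 0ᵣ <ᵣ normSq z
≠0⇒0<normSq z z≠0 = 0<-resp-≈ᵣ (sqrtᵣ-square (normSq z) (normSq-nonNeg z))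
  (0<-* {∣ z ∣} {∣ z ∣} z≠0 z≠0)

0<normSq⇒≠0 : ∀ z → 0ᵣ <ᵣ normSq z → z ≠0
0<normSq⇒≠0 z h = 0<-*-cancel {∣ z ∣} {∣ z ∣} 0≤∣z∣ 0≤∣z∣
  (0<-resp-≈ᵣ (ℝR.sym (sqrtᵣ-square (normSq z) (normSq-nonNeg z))) h)
  where 0≤∣z∣ = sqrtᵣ-nonNeg (normSq z) (normSq-nonNeg z)

_⁻¹[_] : (z : ℂ) → z ≠0 → ℂ
(z ⁻¹[ z≠0 ]) .re = re z *ᵣ (normSq z ⁻¹ᵣ) {≠0⇒0<normSq z z≠0}
(z ⁻¹[ z≠0 ]) .im = -ᵣ (im z *ᵣ (normSq z ⁻¹ᵣ) {≠0⇒0<normSq z z≠0})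

*-inverseʳ : ∀ z (z≠0 : z ≠0) → z * z ⁻¹[ z≠0 ] ≈ 1ℂ
*-inverseʳ z z≠0 =
  ℝR.trans
    (≗⇒≈ᵣ {y = normSq z *ᵣ N⁻¹} (λ n → solve 3 (λ a b m →
      a :* (a :* m) :+ :- (b :* (:- (b :* m))) := (a :* a :+ b :* b) :* m) refl
      (seq (re z) n) (seq (im z) n) (seq N⁻¹ n)))
    (*ᵣ-inverseʳ (normSq z) (≠0⇒0<normSq z z≠0)) ,
  ≗⇒≈ᵣ (λ n → solve 3 (λ a b m →
      a :* (:- (b :* m)) :+ b :* (a :* m) := con 0ℚ) refl
      (seq (re z) n) (seq (im z) n) (seq N⁻¹ n))
  where
  open +-*-Solver using (solve; _:+_; _:*_; :-_; _:=_; con)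
  N⁻¹ = (normSq z ⁻¹ᵣ) {≠0⇒0<normSq z z≠0}

_/_[_] : ℂ → (w : ℂ) → w ≠0 → ℂ
z / w [ w≠0 ] = z * w ⁻¹[ w≠0 ]

private
  normSq-cong : ∀ {z w} → z ≈ w → normSq z ≈ᵣ normSq w
  normSq-cong (p , q) = ℝR.+-cong (ℝR.*-cong p p) (ℝR.*-cong q q)

  normSq-* : ∀ z w → normSq (z * w) ≈ᵣ normSq z *ᵣ normSq w
  normSq-* z w = ≗⇒≈ᵣ λ n → solve 4 (λ a b c d →
    (a :* c :+ :- (b :* d)) :* (a :* c :+ :- (b :* d)) :+
    (a :* d :+ b :* c) :* (a :* d :+ b :* c) :=
    (a :* a :+ b :* b) :* (c :* c :+ d :* d)) refl
    (seq (re z) n) (seq (im z) n) (seq (re w) n) (seq (im w) n)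
    where open +-*-Solver using (solve; _:+_; _:*_; :-_; _:=_)

  0<1-normSq : ∀ z → ∣ z ∣ <ᵣ 1ᵣ → 0ᵣ <ᵣ 1ᵣ +ᵣ -ᵣ normSq z
  0<1-normSq z (η , 0<η , N , h) =
    0<-resp-≈ᵣ (ℝR.+-cong (ℝR.refl {1ᵣ}) (ℝR.-‿cong (sqrtᵣ-square (normSq z) (normSq-nonNeg z))))
      (η , 0<η , N , λ n p → Rat.square-gap (seq ∣ z ∣ n) η
        (sqrtᵣ-nonNeg (normSq z) (normSq-nonNeg z) n) 0<η (h n p))

  0<normSq[z²-1] : ∀ z → ∣ z ∣ <ᵣ 1ᵣ → 0ᵣ <ᵣ normSq (z * z - 1ℂ)
  0<normSq[z²-1] z ∣z∣<1 = let η , 0<η , N , h = 0<1-normSq z ∣z∣<1 in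
    η Q.* η , Rat.*-pos {η} {η} 0<η 0<η , N , λ n p →
    Rat.normSq-gap (seq (re z) n) (seq (im z) n) η 0<η (h n p)

-- The denominator ρ - ρ⁻¹ of V does not vanish when ∣ ρ ∣ < 1.
z-z⁻¹≠0 : ∀ z (z≠0 : z ≠0) → ∣ z ∣ <ᵣ 1ᵣ → (z - z ⁻¹[ z≠0 ]) ≠0
z-z⁻¹≠0 z z≠0 ∣z∣<1 = 0<normSq⇒≠0 (z - z⁻¹)
  (0<-*-cancel {normSq (z - z⁻¹)} {normSq z} (normSq-nonNeg (z - z⁻¹)) (normSq-nonNeg z)
    (0<-resp-≈ᵣ (ℝR.trans (normSq-cong factor) (normSq-* (z - z⁻¹) z)) (0<normSq[z²-1] z ∣z∣<1)))
  where
  z⁻¹ = z ⁻¹[ z≠0 ]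
  factor : z * z - 1ℂ ≈ (z - z⁻¹) * z
  factor = ≈-sym (≈-trans (*-distribʳ-+ z z (- z⁻¹))
    (ℂR.+-cong (≈-refl {z * z}) (≈-trans (≈-sym (-‿distribˡ-* z⁻¹ z))
      (ℂR.-‿cong (≈-trans (*-comm z⁻¹ z) (*-inverseʳ z z≠0))))))
    where open RingProperties ℂR.ring using (-‿distribˡ-*)

open RawSemiringDefs (Semiring.rawSemiring ℂR.semiring) public using (_^_; sum) renaming (_×_ to _×ℂ_)

zpow : (z : ℂ) → z ≠0 → ℤ → ℂ
zpow z z≠0 (Z.+ n)  = z ^ n
zpow z z≠0 -[1+ n ] = (z ⁻¹[ z≠0 ]) ^ suc n

-- Coefficients in increasing degree.
Polynomial : Set
Polynomial = List ℂ

⟦_⟧ : Polynomial → ℂ → ℂ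
⟦ p ⟧ x = foldr (λ c v → c + x * v) 0ℂ p

coeff : Polynomial → ℕ → ℂ
coeff []      _       = 0ℂ
coeff (c ∷ p) zero    = c
coeff (c ∷ p) (suc i) = coeff p i

HasDegree : Polynomial → ℕ → Set
HasDegree p d = coeff p d ≠0 × (∀ i → d N.< i → coeff p i ≈ 0ℂ)

-- γ lists the roots of p in ℂ, all of them and each exactly once.
EnumeratesRoots : ∀ {d} → (Fin d → ℂ) → Polynomial → Set
EnumeratesRoots γ p =
  Injective _≡_ _≈_ γ × (∀ x → ⟦ p ⟧ x ≈ 0ℂ ⇔ (∃ λ a → γ a ≈ x))

IsP : ℕ → Polynomial → Set
IsP r p = ∀ z (z≠0 : z ≠0) →
  ⟦ p ⟧ (z + z ⁻¹[ z≠0 ]) ≈ zpow z z≠0 (Z.+ r) + zpow z z≠0 (Z.- (Z.+ r))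

-- The index i : Fin k stands for r = i + 1, so r runs over 1, …, k.
Φ : (ℕ → Polynomial) → ℕ → ℂ → ℂ
Φ P k x = (2 N.* k) ×ℂ 1ℂ - sum {k} (λ i → ⟦ P (suc (toℕ i)) ⟧ x)

IsΨ : (ℕ → Polynomial) → ℕ → Polynomial → Set
IsΨ P k Ψ = HasDegree Ψ (k N.∸ 1) × (∀ x → Φ P k x ≈ (2 ×ℂ 1ℂ - x) * ⟦ Ψ ⟧ x)

V : (ρ : ℂ) → ρ ≠0 → ∣ ρ ∣ <ᵣ 1ᵣ → ℤ → ℂ
V ρ ρ≠0 ∣ρ∣<1 n =
  (zpow ρ ρ≠0 n - zpow ρ ρ≠0 (Z.- n)) / (ρ - ρ ⁻¹[ ρ≠0 ]) [ z-z⁻¹≠0 ρ ρ≠0 ∣ρ∣<1 ]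

{-# OPTIONS --safe #-}
-- Both n ↦ ρⁿ and n ↦ ρ⁻ⁿ satisfy xₙ₊₁ + xₙ₋₁ ≈ (ρ + ρ⁻¹) xₙ, hence so does their
-- difference divided by the constant ρ - ρ⁻¹.
module Submission where

open import Algebra.Bundles using (CommutativeRing)
open import Data.Fin.Base using (Fin)
open import Data.Integer.Base as ℤ using (ℤ; +_; -[1+_]; 1ℤ) renaming (_+_ to _+ℤ_; _-_ to _-ℤ_)
import Data.Integer.Properties as ℤₚ
open import Data.Nat.Base using (ℕ; zero; suc; _≤_; _∸_)
open import Relation.Binary.PropositionalEquality as ≡ using (_≡_; cong; subst)
import Algebra.Properties.CommutativeSemigroup as CommutativeSemigroupProperties
import Algebra.Properties.Group as GroupProperties
import Algebra.Properties.Ring as RingProperties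

-- In any commutative ring, za - wb = (z + w)(a - b) - (wa - zb). Put z = ρ, w = ρ⁻¹, a = ρⁿ, b =
-- ρ⁻ⁿ: the left side becomes the numerator of V at n + 1, while a - b and wa - zb become those at n
-- and n - 1. The common denominator is carried along as a constant factor d. The identity itself is
-- `difference-recurrence`. What remains is that multiplying by ρ or ρ⁻¹ shifts the exponent by one
-- across all of ℤ: `zpow-suc` proves this, and the other three shift laws follow from it.

module _ {c ℓ} (R : CommutativeRing c ℓ) where
  open CommutativeRing R hiding (zero)
  open CommutativeSemigroupProperties +-commutativeSemigroup using (interchange)
  open GroupProperties +-group using (//-rightDividesʳ)
  open RingProperties ring using (-‿distribʳ-*)
  open import Relation.Binary.Reasoning.Setoid setoid

  *-cancelInverse : ∀ {x y} z → x * y ≈ 1# → x * (y * z) ≈ z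
  *-cancelInverse {x} {y} z xy≈1 = begin
    x * (y * z)  ≈⟨ *-assoc x y z ⟨
    (x * y) * z  ≈⟨ *-congʳ xy≈1 ⟩
    1# * z       ≈⟨ *-identityˡ z ⟩
    z            ∎

  -- Here z and w are arbitrary: wz = 1 matters only for the exponent shifts.
  difference-recurrence : ∀ z w a b d →
    (z * a - w * b) * d ≈ (z + w) * ((a - b) * d) - (w * a - z * b) * d
  difference-recurrence z w a b d = begin
    -- Add and subtract y * d, since x + y factors as (z + w)(a - b).
    x * d                            ≈⟨ //-rightDividesʳ (y * d) (x * d) ⟨
    (x * d + y * d) - y * d          ≈⟨ +-congʳ (distribʳ d x y) ⟨
    (x + y) * d - y * d              ≈⟨ +-congʳ (*-congʳ x+y) ⟩
    ((z + w) * (a - b)) * d - y * d  ≈⟨ +-congʳ (*-assoc (z + w) (a - b) d) ⟩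
    (z + w) * ((a - b) * d) - y * d  ∎
    where
    x = z * a - w * b
    y = w * a - z * b
    x+y : x + y ≈ (z + w) * (a - b)
    x+y = begin
      (z * a - w * b) + (w * a - z * b)
        ≈⟨ interchange (z * a) (- (w * b)) (w * a) (- (z * b)) ⟩
      (z * a + w * a) + (- (w * b) - z * b)
        ≈⟨ +-cong (sym (distribʳ a z w)) (+-cong (-‿distribʳ-* w b) (-‿distribʳ-* z b)) ⟩
      (z + w) * a + (w * - b + z * - b)
        ≈⟨ +-congˡ (+-comm (w * - b) (z * - b)) ⟩
      (z + w) * a + (z * - b + w * - b)
        ≈⟨ +-congˡ (sym (distribʳ (- b) z w)) ⟩
      (z + w) * a + (z + w) * - b
        ≈⟨ distribˡ (z + w) a (- b) ⟨
      (z + w) * (a - b) ∎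

open import Defs

module _ (z : ℂ) (z≠0 : z ≠0) where

  zpow-suc : ∀ n → zpow z z≠0 (n +ℤ 1ℤ) ≈ z * zpow z z≠0 n
  -- With 1 on the left the sum computes in each case of `go`, so only the cancellation of z against
  -- z⁻¹ is left to prove.
  zpow-suc n = subst (λ m → zpow z z≠0 m ≈ z * zpow z z≠0 n) (ℤₚ.+-comm 1ℤ n) (go n)
    where
    go : ∀ n → zpow z z≠0 (ℤ.suc n) ≈ z * zpow z z≠0 n
    go (+ n)        = ≈-refl
    -- The crossing from exponent -1 to 0, where the two clauses of `zpow` meet.
    go -[1+ zero ]  = ≈-sym (*-cancelInverse ℂ-commutativeRing 1ℂ (*-inverseʳ z z≠0))
    go -[1+ suc n ] =
      ≈-sym (*-cancelInverse ℂ-commutativeRing (z ⁻¹[ z≠0 ] ^ suc n) (*-inverseʳ z z≠0))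

  -- Multiply `zpow-suc` at n - 1 by z⁻¹; no second case split on the sign is required.
  zpow-pred : ∀ n → zpow z z≠0 (n -ℤ 1ℤ) ≈ z ⁻¹[ z≠0 ] * zpow z z≠0 n
  zpow-pred n = ≈-trans
    (≈-sym (*-cancelInverse ℂ-commutativeRing (zpow z z≠0 (n -ℤ 1ℤ))
      (≈-trans (*-comm (z ⁻¹[ z≠0 ]) z) (*-inverseʳ z z≠0))))
    (*-cong ≈-refl (≈-trans (≈-sym (zpow-suc (n -ℤ 1ℤ)))
      (ℂR.reflexive (cong (zpow z z≠0) n-1+1))))
    where
    n-1+1 : (n -ℤ 1ℤ) +ℤ 1ℤ ≡ n
    n-1+1 = ≡.trans (ℤₚ.+-assoc n (ℤ.- 1ℤ) 1ℤ) (ℤₚ.+-identityʳ n)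

  zpow-neg-suc : ∀ n → zpow z z≠0 (ℤ.- (n +ℤ 1ℤ)) ≈ z ⁻¹[ z≠0 ] * zpow z z≠0 (ℤ.- n)
  zpow-neg-suc n = subst (λ m → zpow z z≠0 m ≈ z ⁻¹[ z≠0 ] * zpow z z≠0 (ℤ.- n))
    (≡.sym (ℤₚ.neg-distrib-+ n 1ℤ)) (zpow-pred (ℤ.- n))

  zpow-neg-pred : ∀ n → zpow z z≠0 (ℤ.- (n -ℤ 1ℤ)) ≈ z * zpow z z≠0 (ℤ.- n)
  zpow-neg-pred n = subst (λ m → zpow z z≠0 m ≈ z * zpow z z≠0 (ℤ.- n))
    (≡.sym (ℤₚ.neg-distrib-+ n (ℤ.- 1ℤ))) (zpow-suc (ℤ.- n))

V-recurrence : ∀ z (z≠0 : z ≠0) (∣z∣<1 : ∣ z ∣ <ᵣ 1ᵣ) n →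
  V z z≠0 ∣z∣<1 (n +ℤ 1ℤ) ≈
  (z + z ⁻¹[ z≠0 ]) * V z z≠0 ∣z∣<1 n - V z z≠0 ∣z∣<1 (n -ℤ 1ℤ)
V-recurrence z z≠0 ∣z∣<1 n = begin
  (p (n +ℤ 1ℤ) - p (ℤ.- (n +ℤ 1ℤ))) * d
    ≈⟨ ℂR.*-congʳ (ℂR.+-cong (zpow-suc z z≠0 n) (ℂR.-‿cong (zpow-neg-suc z z≠0 n))) ⟩
  (z * p n - w * p (ℤ.- n)) * d
    ≈⟨ difference-recurrence ℂ-commutativeRing z w (p n) (p (ℤ.- n)) d ⟩
  (z + w) * V z z≠0 ∣z∣<1 n - (w * p n - z * p (ℤ.- n)) * d
    -- Read from right to left: the shift laws for n - 1 fold the last term back into V.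
    ≈⟨ ℂR.+-congˡ (ℂR.-‿cong (ℂR.*-congʳ
         (ℂR.+-cong (zpow-pred z z≠0 n) (ℂR.-‿cong (zpow-neg-pred z z≠0 n))))) ⟨
  (z + w) * V z z≠0 ∣z∣<1 n - V z z≠0 ∣z∣<1 (n -ℤ 1ℤ) ∎
  where
  open import Relation.Binary.Reasoning.Setoid ℂR.setoid
  p = zpow z z≠0
  w = z ⁻¹[ z≠0 ]
  d = (z - w) ⁻¹[ z-z⁻¹≠0 z z≠0 ∣z∣<1 ]

lemma3p3 : (P : ℕ → Polynomial) →
    (∀ r → 1 ≤ r → IsP r (P r)) →
    ∀ k → 1 ≤ k →
    (Ψ : Polynomial) → IsΨ P k Ψ →
    (γ : Fin (k ∸ 1) → ℂ) → EnumeratesRoots γ Ψ →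
    (ρ : Fin (k ∸ 1) → ℂ) →
    (ρ≠0 : ∀ a → ρ a ≠0) →
    (∀ a → ρ a + ρ a ⁻¹[ ρ≠0 a ] ≈ γ a) →
    (∣ρ∣<1 : ∀ a → ∣ ρ a ∣ <ᵣ 1ᵣ) →
    ∀ a (n : ℤ) →
    V (ρ a) (ρ≠0 a) (∣ρ∣<1 a) (n +ℤ 1ℤ) ≈
    γ a * V (ρ a) (ρ≠0 a) (∣ρ∣<1 a) n - V (ρ a) (ρ≠0 a) (∣ρ∣<1 a) (n -ℤ 1ℤ)
lemma3p3 P isP k 1≤k Ψ isΨ γ roots ρ ρ≠0 ρ+ρ⁻¹≈γ ∣ρ∣<1 a n =
  -- The coefficient ρ + ρ⁻¹ is then replaced by the root it equals.
  ≈-trans (V-recurrence (ρ a) (ρ≠0 a) (∣ρ∣<1 a) n)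
    (ℂR.+-congʳ (ℂR.*-congʳ (ρ+ρ⁻¹≈γ a)))
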